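{- Let $S=S'\wedge C$ be a scheduling problem on $n$ elements where $C$ is a contractible clause, let $V(C)=O_1\uplus\cdots\uplus O_k$ be the decomposition into $\sim_C$ equivalence classes ordered so that $O_i>O_j$ for $i<j$, and let $r_i=|O_i|-1$. Then $$\mathcal{S}_S=\mathcal{S}_{S'}-\left(\mathcal{S}_{S'\downarrow_{(r_1,\dots,r_k)}}\right)\uparrow^{(r_1,\dots,r_k)}.$$
   Context: A scheduling problem on $n$ elements is a Boolean formula over atoms $(x_i\le x_j)$, $i,j\in[n]$, with $(x_i=x_j)=(x_i\le x_j)\wedge(x_j\le x_i)$ and $(x_i\ne x_j)=\neg(x_i=x_j)$. A solution is $f:[n]\to\mathbb{P}=\{1,2,\dots\}$ making it true with $x_i=f(i)$; $\mathcal{S}_S=\sum_f y_{f(1)}\cdots y_{f(n)}$ over solutions, in noncommuting variables $y_1,y_2,\dots$. A formula $C$ given as $C=\bigvee_{(i,j)\in I}(x_i\ne x_j)$ with $I\subseteq[n]\times[n]$ is edge-like; $V(C)$ is the set of indices $i$ with $x_i$ appearing in $C$, and $\sim_C$ is the equivalence relation on $V(C)$ generated by $i\sim j$ for $(i,j)\in I$. For disjoint sets, $A>B$ means $a>b$ for all $a\in A,b\in B$. $C$ is a contractible clause if it is edge-like, $V(C)=\{m,m+1,\dots,n\}$ for some $1\le m\le n$, and the $\sim_C$ classes can be ordered $O_1,\dots,O_k$ with $O_i>O_j$ for $i<j$. With $r=\sum_i r_i$, the contraction $S'\downarrow_{(r_1,\dots,r_k)}$ is the scheduling problem on $n-r$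 elements obtained from $S'$ by replacing each variable $x_j$ by $x_{\psi(j)}$, where $\psi(j)=j$ for $j<m$ and $\psi(j)=m+k-i$ for $j\in O_i$. Induction: for nonnegative integers $r_1,\dots,r_k$ and a monomial $y_{i_1}\cdots y_{i_p}$ with $k\le p$, $y_{i_1}\cdots y_{i_p}\uparrow^{(r_1,\dots,r_k)}=y_{i_1}\cdots y_{i_{p-k}}y_{i_{p-k+1}}^{1+r_k}\cdots y_{i_p}^{1+r_1}$, extended linearly (termwise). -}

module Defs where

open import Algebra.Properties.CommutativeMonoid.Sum as NatSum using ()
open import Data.Bool.Base as Bool using (Bool; true; false; if_then_else_)
open import Data.Empty using (⊥)
open import Data.Fin.Base as Fin using (Fin; zero; suc; toℕ; fromℕ<; opposite)
open import Data.Fin.Properties as Finₚ using ()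
open import Data.Fin.Subset using (Subset; Nonempty; ∣_∣) renaming (_∈_ to _∈ˢ_)
open import Data.Integer.Base as ℤ using (ℤ; 0ℤ; 1ℤ)
open import Data.List.Base as List using (List; []; _∷_; length)
open import Data.List.Membership.Propositional using () renaming (_∈_ to _∈ˡ_)
open import Data.List.Properties using (≡-dec)
open import Data.Nat.Base as ℕ using (ℕ; zero; suc; NonZero; z≤n; s≤s)
open import Data.Nat.Properties as ℕₚ using ()
open import Data.Product.Base using (∃; _×_; _,_; proj₁; proj₂)
open import Data.Refinement.Base using (Refinement; value)
open import Data.Refinement.Properties as Refinementₚ using ()
open import Data.Sum.Base using (_⊎_)
open import Data.Vec.Base as Vec using ()
open import Data.Vec.Properties as Vecₚ using ()
open import Function.Base using (_∘_)
open import Function.Bundles using (_⇔_; Equivalence)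
open import Relation.Binary.Construct.Closure.Equivalence using (EqClosure)
open import Relation.Binary.Definitions using (DecidableEquality; tri<; tri≈; tri>)
open import Relation.Binary.PropositionalEquality
open import Relation.Nullary.Decidable using (yes; no; does; _×-dec_)
open import Relation.Nullary.Negation using (contradiction)

open NatSum ℕₚ.+-0-commutativeMonoid using (sum; sum-syntax; ∑-comm; ∑-distrib-+; sum-cong-≗)

ℙ : Set
ℙ = Refinement ℕ NonZero

_≟ℙ_ : DecidableEquality ℙ
_≟ℙ_ = Refinementₚ._≟_ ℕₚ._≟_

-- The word i₁ ∷ … ∷ iₚ ∷ [] stands for the monomial y_{i₁} ⋯ y_{iₚ}.
Word : Set
Word = List ℙ

_≟ʷ_ : DecidableEquality Word
_≟ʷ_ = ≡-dec _≟ℙ_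

-- A series is given by its coefficients; equality of series is _≗_.
Series : Set
Series = Word → ℤ

infixl 6 _-ˢ_

_-ˢ_ : Series → Series → Series
(F -ˢ G) w = F w ℤ.- G w

-- The indices 1, …, n are represented by the elements 0, …, n-1 of Fin n.
data Formula (n : ℕ) : Set where
  _≤′_    : Fin n → Fin n → Formula n
  false′  : Formula n
  ¬′_     : Formula n → Formula n
  _∧′_    : Formula n → Formula n → Formula n
  _∨′_    : Formula n → Formula n → Formula n

infix  8 _≤′_ _=′_ _≠′_
infix  7 ¬′_
infixr 6 _∧′_
infixr 5 _∨′_

_=′_ : ∀ {n} → Fin n → Fin n → Formula n
i =′ j = i ≤′ j ∧′ j ≤′ i

_≠′_ : ∀ {n} → Fin n → Fin n → Formula n
i ≠′ j = ¬′ (i =′ j)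

eval : ∀ {n} → Formula n → (Fin n → ℙ) → Bool
eval (i ≤′ j) f = does (value (f i) ℕₚ.≤? value (f j))
eval false′   f = false
eval (¬′ A)   f = Bool.not (eval A f)
eval (A ∧′ B) f = eval A f Bool.∧ eval B f
eval (A ∨′ B) f = eval A f Bool.∨ eval B f

rename : ∀ {n p} → (Fin n → Fin p) → Formula n → Formula p
rename ρ (i ≤′ j) = ρ i ≤′ ρ j
rename ρ false′   = false′
rename ρ (¬′ A)   = ¬′ rename ρ A
rename ρ (A ∧′ B) = rename ρ A ∧′ rename ρ B
rename ρ (A ∨′ B) = rename ρ A ∨′ rename ρ B

_occursIn_ : ∀ {n} → Fin n → Formula n → Set
i occursIn (j ≤′ l) = i ≡ j ⊎ i ≡ l
i occursIn false′   = ⊥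
i occursIn (¬′ A)   = i occursIn A
i occursIn (A ∧′ B) = i occursIn A ⊎ i occursIn B
i occursIn (A ∨′ B) = i occursIn A ⊎ i occursIn B

-- The coefficient at w of the sum of y_{f(1)} ⋯ y_{f(n)} over the solutions f.
-- A word of length n is y_{f(1)} ⋯ y_{f(n)} for exactly one f : Fin n → ℙ,
-- namely its lookup function, so the coefficient is 1 if this f is a solution
-- and 0 otherwise.
𝒮 : ∀ {n} → Formula n → Series
𝒮 {n} S w with length w ℕₚ.≟ n
... | yes refl = if eval S (List.lookup w) then 1ℤ else 0ℤ
... | no  _    = 0ℤ

-- y_{i₁} ⋯ y_{iₚ} ↑^(r₁,…,r_k): the last k letters get the exponents
-- 1 + r_k, …, 1 + r₁, in this order.  Only meaningful for k ≤ p.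
_↑ʷ_ : ∀ {k} → Word → (Fin k → ℕ) → Word
_↑ʷ_ {k} u r = List.take q u List.++ List.concat
  (List.zipWith (λ e y → List.replicate (1 ℕ.+ e) y)
    (List.tabulate (r ∘ opposite)) (List.drop q u))
  where q = length u ℕ.∸ k

wordsOver : List ℙ → ℕ → List Word
wordsOver A zero    = [] ∷ []
wordsOver A (suc p) = List.cartesianProductWith _∷_ A (wordsOver A p)

-- All monomials u of degree at least k with u ↑ʷ r ≡ w: such a u satisfies
-- length w ≡ length u + (r₁ + ⋯ + r_k), and its letters are letters of w.
-- Without deduplicate a word could be listed more than once.
preimages : ∀ {k} → (Fin k → ℕ) → Word → List Word
preimages {k} r w =
  List.filter (λ u → (k ℕₚ.≤? length u) ×-dec ((u ↑ʷ r) ≟ʷ w))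
    (wordsOver (List.deduplicate _≟ℙ_ w) (length w ℕ.∸ sum r))

-- The termwise extension of _↑ʷ_ to series all of whose terms have degree at
-- least k (terms of smaller degree, on which induction is undefined, are
-- dropped).
infixl 7 _↑_

_↑_ : ∀ {k} → Series → (Fin k → ℕ) → Series
(F ↑ r) w = List.foldr ℤ._+_ 0ℤ (List.map F (preimages r w))

-- I ⊆ [n] × [n], as a list of its elements.
Edges : ℕ → Set
Edges n = List (Fin n × Fin n)

⋁≠ : ∀ {n} → Edges n → Formula n
⋁≠ = List.foldr (λ (i , j) A → i ≠′ j ∨′ A) false′

-- On the indices occurring in ⋁≠ I this is the equivalence relation ∼_C; each
-- remaining index is related only to itself.
_⊢_∼_ : ∀ {n} → Edges n → Fin n → Fin n → Set
I ⊢ i ∼ j = EqClosure (λ a b → (a , b) ∈ˡ I) i j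

-- The class O_i of the mathematical notation is O (i - 1).
record ContractibleClause {n : ℕ} (C : Formula n) : Set where
  field
    I          : Edges n
    edge-like  : C ≡ ⋁≠ I
    m          : Fin n
    V-interval : ∀ j → j occursIn C ⇔ m Fin.≤ j
    k          : ℕ
    O          : Fin k → Subset n
    O-cover    : ∀ j → j occursIn C ⇔ ∃ λ i → j ∈ˢ O i
    O-nonempty : ∀ i → Nonempty (O i)
    O-class    : ∀ i {a b} → a ∈ˢ O i → (b ∈ˢ O i ⇔ I ⊢ a ∼ b)
    O-ordered  : ∀ {i j} → i Fin.< j → ∀ {a b} → a ∈ˢ O i → b ∈ˢ O j → a Fin.> b

  r : Fin k → ℕ
  r i = ∣ O i ∣ ℕ.∸ 1

private

  ind : Bool → ℕ
  ind b = if b then 1 else 0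

  card≡∑ : ∀ {n} (p : Subset n) → ∣ p ∣ ≡ ∑[ j < n ] ind (Vec.lookup p j)
  card≡∑ Vec.[]            = refl
  card≡∑ (true  Vec.∷ p) = cong suc (card≡∑ p)
  card≡∑ (false Vec.∷ p) = card≡∑ p

  ∑-zero : ∀ {k} (t : Fin k → ℕ) → (∀ i → t i ≡ 0) → sum t ≡ 0
  ∑-zero {zero}  t t≡0 = refl
  ∑-zero {suc k} t t≡0 = cong₂ ℕ._+_ (t≡0 zero) (∑-zero (t ∘ suc) (t≡0 ∘ suc))

  ∑-single : ∀ {k} (t : Fin k → ℕ) i → t i ≡ 1 → (∀ j → j ≢ i → t j ≡ 0) → sum t ≡ 1
  ∑-single t zero    t≡1 t≡0 =
    cong₂ ℕ._+_ t≡1 (∑-zero (t ∘ suc) (λ j → t≡0 (suc j) λ ()))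
  ∑-single t (suc i) t≡1 t≡0 =
    cong₂ ℕ._+_ (t≡0 zero λ ())
      (∑-single (t ∘ suc) i t≡1 (λ j j≢i → t≡0 (suc j) (j≢i ∘ Finₚ.suc-injective)))

  ∑-ones : ∀ k → ∑[ i < k ] 1 ≡ k
  ∑-ones zero    = refl
  ∑-ones (suc k) = cong suc (∑-ones k)

  ∑-interval : ∀ {n} (m : Fin n) (t : Fin n → ℕ) →
               (∀ j → m Fin.≤ j → t j ≡ 1) → (∀ j → j Fin.< m → t j ≡ 0) →
               toℕ m ℕ.+ sum t ≡ n
  ∑-interval {n} zero t t≡1 t≡0 =
    trans (sum-cong-≗ {n} {t} {λ _ → 1} (λ j → t≡1 j z≤n)) (∑-ones n)
  ∑-interval (suc m) t t≡1 t≡0 rewrite t≡0 zero (s≤s z≤n) =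
    cong suc (∑-interval m (t ∘ suc) (λ j → t≡1 (suc j) ∘ s≤s) (λ j → t≡0 (suc j) ∘ s≤s))

module _ {n : ℕ} {C : Formula n} (c : ContractibleClause C) where
  open ContractibleClause c

  private

    inO : Fin k → Fin n → ℕ
    inO i j = ind (Vec.lookup (O i) j)

    inO-yes : ∀ {i j} → j ∈ˢ O i → inO i j ≡ 1
    inO-yes j∈ = cong ind (Vecₚ.[]=⇒lookup j∈)

    inO-no : ∀ i j → (j ∈ˢ O i → ⊥) → inO i j ≡ 0
    inO-no i j j∉ with Vec.lookup (O i) j in eq
    ... | true  = contradiction (Vecₚ.lookup⇒[]= j (O i) eq) j∉
    ... | false = refl

    O-disjoint : ∀ {i i′ j} → j ∈ˢ O i → j ∈ˢ O i′ → i ≡ i′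
    O-disjoint {i} {i′} p q with Finₚ.<-cmp i i′
    ... | tri< i<i′ _ _ = contradiction (O-ordered i<i′ p q) (ℕₚ.<-irrefl refl)
    ... | tri≈ _ i≡i′ _ = i≡i′
    ... | tri> _ _ i′<i = contradiction (O-ordered i′<i q p) (ℕₚ.<-irrefl refl)

    column-in : ∀ j → m Fin.≤ j → ∑[ i < k ] inO i j ≡ 1
    column-in j m≤j with Equivalence.to (O-cover j) (Equivalence.from (V-interval j) m≤j)
    ... | i , j∈ = ∑-single (λ i → inO i j) i (inO-yes j∈)
      (λ i′ i′≢i → inO-no i′ j (λ j∈′ → i′≢i (O-disjoint j∈′ j∈)))

    column-out : ∀ j → j Fin.< m → ∑[ i < k ] inO i j ≡ 0
    column-out j j<m = ∑-zero (λ i → inO i j) λ i → inO-no i j λ j∈ →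
      ℕₚ.<⇒≱ j<m (Equivalence.to (V-interval j) (Equivalence.from (O-cover j) (i , j∈)))

    card-pos : ∀ {p} (P : Subset p) → Nonempty P → 1 ℕ.≤ ∣ P ∣
    card-pos (true  Vec.∷ P) _ = s≤s z≤n
    card-pos (false Vec.∷ P) (suc j , Vec.there j∈) = card-pos P (j , j∈)

    ∑-card : ∑[ i < k ] ∣ O i ∣ ≡ k ℕ.+ sum r
    ∑-card = begin
      ∑[ i < k ] ∣ O i ∣          ≡⟨ sum-cong-≗ {k} (λ i → sym (ℕₚ.m+[n∸m]≡n (card-pos (O i) (O-nonempty i)))) ⟩
      ∑[ i < k ] (1 ℕ.+ r i)      ≡⟨ ∑-distrib-+ {k} (λ _ → 1) r ⟩
      (∑[ i < k ] 1) ℕ.+ sum r    ≡⟨ cong (ℕ._+ sum r) (∑-ones k) ⟩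
      k ℕ.+ sum r                 ∎
      where open ≡-Reasoning

  contracted-size : toℕ m ℕ.+ k ≡ n ℕ.∸ sum r
  contracted-size = begin
    toℕ m ℕ.+ k                          ≡⟨ ℕₚ.m+n∸n≡m (toℕ m ℕ.+ k) (sum r) ⟨
    toℕ m ℕ.+ k ℕ.+ sum r ℕ.∸ sum r      ≡⟨ cong (ℕ._∸ sum r) (ℕₚ.+-assoc (toℕ m) k (sum r)) ⟩
    toℕ m ℕ.+ (k ℕ.+ sum r) ℕ.∸ sum r    ≡⟨ cong (λ s → toℕ m ℕ.+ s ℕ.∸ sum r) ∑-card ⟨
    toℕ m ℕ.+ (∑[ i < k ] ∣ O i ∣) ℕ.∸ sum r
      ≡⟨ cong (λ s → toℕ m ℕ.+ s ℕ.∸ sum r) (sum-cong-≗ {k} (card≡∑ ∘ O)) ⟩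
    toℕ m ℕ.+ (∑[ i < k ] ∑[ j < n ] inO i j) ℕ.∸ sum r
      ≡⟨ cong (λ s → toℕ m ℕ.+ s ℕ.∸ sum r) (∑-comm inO) ⟩
    toℕ m ℕ.+ (∑[ j < n ] ∑[ i < k ] inO i j) ℕ.∸ sum r
      ≡⟨ cong (ℕ._∸ sum r) (∑-interval m (λ j → ∑[ i < k ] inO i j) column-in column-out) ⟩
    n ℕ.∸ sum r                          ∎
    where open ≡-Reasoning

  -- In one-based indices: j for j < m, and m + k - i for j ∈ O_i.
  ψ : Fin n → Fin (n ℕ.∸ sum r)
  ψ j with m Finₚ.≤? j
  ... | no  m≰j = fromℕ< {toℕ j} (subst (toℕ j ℕ.<_) contracted-size
                    (ℕₚ.<-≤-trans (ℕₚ.≰⇒> m≰j) (ℕₚ.m≤m+n (toℕ m) k)))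
  ... | yes m≤j = fromℕ< {toℕ m ℕ.+ toℕ (opposite i)} (subst (toℕ m ℕ.+ toℕ (opposite i) ℕ.<_)
                    contracted-size (ℕₚ.+-monoʳ-< (toℕ m) (Finₚ.toℕ<n (opposite i))))
    where
    i : Fin k
    i = proj₁ (Equivalence.to (O-cover j) (Equivalence.from (V-interval j) m≤j))

  contraction : Formula n → Formula (n ℕ.∸ sum r)
  contraction = rename ψ

{-# OPTIONS --safe #-}

-- An assignment f falsifies C exactly when it is constant on the classes
-- O₁, …, O_k, that is, when f = g ∘ ψ for some g, which is unique because ψ is
-- surjective.  Since ψ is monotone, the word of g ∘ ψ is the word of g with each
-- letter repeated as often as ψ attains its position, and this is the induction
-- ↑^(r₁,…,r_k).  So the solutions of S′ lost on adding C are the induced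
-- solutions of the contraction, each counted once.
module Submission where

open import Defs
open import Algebra.Properties.CommutativeMonoid.Sum as Sum using ()
open import Data.Bool.Base using (Bool; true; false; if_then_else_; not; _∧_; _∨_)
open import Data.Bool.Properties using (∧-identityʳ; ∧-zeroʳ)
open import Data.Fin.Base as Fin using (Fin; zero; suc; toℕ; fromℕ<; opposite)
open import Data.Fin.Properties as Finₚ using ()
open import Data.Fin.Subset using (Subset; ∣_∣; ⁅_⁆) renaming (_∈_ to _∈ˢ_)
open import Data.Fin.Subset.Properties
  using (⊆-antisym; x∈⁅x⁆; x∈⁅y⁆⇒x≡y; ∣⁅x⁆∣≡1; p⊆q⇒∣p∣≤∣q∣)
open import Data.Integer.Base as ℤ using (ℤ; 0ℤ; 1ℤ)
import Data.Integer.Properties as ℤₚ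
open import Data.List.Base
  using (List; []; _∷_; _++_; length; map; foldr; concat; replicate; tabulate; lookup; deduplicate; take; drop; zipWith)
open import Data.List.Membership.Propositional using (_∈_)
open import Data.List.Membership.Propositional.Properties
  using (∈-cartesianProductWith⁺; ∈-cartesianProductWith⁻; ∈-filter⁺; ∈-filter⁻;
         ∈-deduplicate⁺; ∈-tabulate⁺; ∈-tabulate⁻)
open import Data.List.Properties
  using (tabulate-lookup; tabulate-cong; length-tabulate; ∷-injective; ∷-injectiveˡ; ∷-injectiveʳ)
open import Data.List.Relation.Unary.All as All using (All; []; _∷_)
open import Data.List.Relation.Unary.Any using (here; there)
open import Data.List.Relation.Unary.AllPairs using ([]; _∷_)
open import Data.List.Relation.Unary.Unique.Propositional using (Unique)
open import Data.List.Relation.Unary.Unique.Propositional.Properties using (cartesianProductWith⁺; filter⁺)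
open import Data.List.Relation.Unary.Unique.DecPropositional.Properties _≟ℙ_ using (deduplicate-!)
open import Data.Nat.Base using (ℕ; zero; suc; _+_; _∸_; _≤_; _<_; z≤n; s≤s)
import Data.Nat.Properties as ℕₚ
open import Data.Product.Base using (∃; _×_; _,_; proj₁; proj₂)
open import Data.Refinement.Base using (value)
open import Data.Refinement.Properties using (value-injective)
open import Data.Sum.Base using ([_,_]′; inj₁; inj₂)
import Data.Vec.Base as Vec
import Data.Vec.Properties as Vecₚ
open import Function.Base using (_∘_)
open import Function.Bundles using (Equivalence)
import Relation.Binary.Construct.Closure.Equivalence as EqClosure
open import Relation.Binary.Definitions using (tri<; tri≈; tri>)
open import Relation.Binary.PropositionalEquality
open import Relation.Nullary.Decidable using (Dec; yes; no; does; dec-true; toSum; _×-dec_)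
open import Relation.Nullary.Negation using (¬_; contradiction)

open Sum ℕₚ.+-0-commutativeMonoid using (sum)
open Equivalence using (to; from)

private variable
  n p : ℕ
  A : Set

-- Lists and their tabulations

tabulate-injective : {f g : Fin n → A} → tabulate f ≡ tabulate g → f ≗ g
tabulate-injective eq zero    = ∷-injectiveˡ eq
tabulate-injective eq (suc i) = tabulate-injective (∷-injectiveʳ eq) i

length≡⇒tabulate : (w : List A) → length w ≡ n → ∃ λ (f : Fin n → A) → w ≡ tabulate f
length≡⇒tabulate w refl = lookup w , sym (tabulate-lookup w)

zipWith-tabulate : ∀ {B C : Set} (_⊕_ : A → B → C) (f : Fin n → A) (g : Fin n → B) →
                   zipWith _⊕_ (tabulate f) (tabulate g) ≡ tabulate (λ i → f i ⊕ g i)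
zipWith-tabulate {n = zero}  _⊕_ f g = refl
zipWith-tabulate {n = suc n} _⊕_ f g = cong (_ ∷_) (zipWith-tabulate _⊕_ (f ∘ suc) (g ∘ suc))

-- A second entry would equal the first, against uniqueness. This collapses a sum over preimages to
-- a single term.
unique-constant : ∀ {x : A} {xs} → Unique xs → x ∈ xs → (∀ {y} → y ∈ xs → y ≡ x) → xs ≡ x ∷ []
unique-constant {xs = y ∷ []}     _                  _ ≡x = cong (_∷ []) (≡x (here refl))
unique-constant {xs = y ∷ z ∷ _} ((y≢z ∷ _) ∷ _) _ ≡x =
  contradiction (trans (≡x (here refl)) (sym (≡x (there (here refl))))) y≢z

-- Fibres of monotone maps

fibre : (Fin n → Fin p) → Fin p → Subset n
fibre ψ i = Vec.tabulate (λ j → does (ψ j Finₚ.≟ i))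

∈-fibre⁺ : (ψ : Fin n → Fin p) {i : Fin p} {j : Fin n} → ψ j ≡ i → j ∈ˢ fibre ψ i
∈-fibre⁺ ψ {i} {j} eq = Vecₚ.lookup⇒[]= j (fibre ψ i)
  (trans (Vecₚ.lookup∘tabulate _ j) (dec-true (ψ j Finₚ.≟ i) eq))

∈-fibre⁻ : (ψ : Fin n → Fin p) {i : Fin p} {j : Fin n} → j ∈ˢ fibre ψ i → ψ j ≡ i
∈-fibre⁻ ψ {i} {j} j∈ with ψ j Finₚ.≟ i | trans (sym (Vecₚ.lookup∘tabulate _ j)) (Vecₚ.[]=⇒lookup j∈)
... | yes eq | _ = eq

Monotone : (Fin n → Fin p) → Set
Monotone ψ = ∀ {i j} → i Fin.≤ j → ψ i Fin.≤ ψ j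

-- Depends on `ψ` only through its fibre sizes. It mediates between induction, which knows only
-- exponents, and `tabulate (g ∘ ψ)`.
fibres : (Fin n → Fin p) → (Fin p → A) → List A
fibres ψ g = concat (tabulate (λ i → replicate ∣ fibre ψ i ∣ (g i)))

fibres-empty : (ψ : Fin 0 → Fin p) (g : Fin p → A) → fibres ψ g ≡ []
fibres-empty {p = zero}  ψ g = refl
fibres-empty {p = suc p} ψ g = fibres-empty (λ ()) (g ∘ suc)

suc-preimage : (i : Fin (suc p)) → Fin.zero {p} Fin.< i → ∃ λ i′ → i ≡ suc i′
suc-preimage (suc i) _ = i , refl

fibre-cong : {ψ φ : Fin n → Fin p} → ψ ≗ φ → fibre ψ ≗ fibre φ
fibre-cong ψ≗φ i = Vecₚ.tabulate-cong (λ j → cong (λ x → does (x Finₚ.≟ i)) (ψ≗φ j))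

fibre-suc-zero : (ψ : Fin n → Fin p) → ∣ fibre (Fin.suc ∘ ψ) zero ∣ ≡ 0
fibre-suc-zero {n = zero}  ψ = refl
fibre-suc-zero {n = suc n} ψ = fibre-suc-zero (ψ ∘ suc)

fibres-suc : (ψ : Fin n → Fin p) (g : Fin (suc p) → A) → fibres (Fin.suc ∘ ψ) g ≡ fibres ψ (g ∘ suc)
fibres-suc ψ g = cong (λ s → replicate s (g zero) ++ fibres ψ (g ∘ suc)) (fibre-suc-zero ψ)

fibres-cong : {ψ φ : Fin n → Fin p} → ψ ≗ φ → (g : Fin p → A) → fibres ψ g ≡ fibres φ g
fibres-cong ψ≗φ g =
  cong concat (tabulate-cong λ i → cong (λ s → replicate ∣ s ∣ (g i)) (fibre-cong ψ≗φ i))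

-- Induction on domain and codomain. If `ψ zero` is `zero`, the first letter opens the first block
-- and index `zero` is removed. Otherwise monotonicity keeps every value away from `zero`, so the
-- first block is empty and `ψ` factors through `suc`, which shrinks the codomain.
fibres≡tabulate : (ψ : Fin n → Fin p) → Monotone ψ → (g : Fin p → A) → fibres ψ g ≡ tabulate (g ∘ ψ)
fibres≡tabulate {n = zero} ψ mono g = fibres-empty ψ g
fibres≡tabulate {n = suc n} {p = zero} ψ mono g with () ← ψ zero
fibres≡tabulate {n = suc n} {p = suc p} ψ mono g with ψ zero in eq
... | zero  = cong (g zero ∷_) (fibres≡tabulate (ψ ∘ suc) (mono ∘ s≤s) g)
... | suc x = begin
  -- The case split has put `suc x` for `ψ zero` inside each fibre; `eq` restores `fibres ψ g`, and
  -- the last step undoes this on the right.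
  concat (tabulate λ i → replicate ∣ does (suc x Finₚ.≟ i) Vec.∷ fibre (ψ ∘ suc) i ∣ (g i))
    ≡⟨ cong concat (tabulate-cong λ i →
         cong (λ y → replicate ∣ does (y Finₚ.≟ i) Vec.∷ fibre (ψ ∘ suc) i ∣ (g i)) (sym eq)) ⟩
  fibres ψ g              ≡⟨ fibres-cong ψ≗suc g ⟩
  fibres (suc ∘ φ) g      ≡⟨ fibres-suc φ g ⟩
  fibres φ (g ∘ suc)      ≡⟨ fibres≡tabulate φ φ-mono (g ∘ suc) ⟩
  tabulate (g ∘ suc ∘ φ)  ≡⟨ tabulate-cong (λ j → cong g (sym (ψ≗suc j))) ⟩
  tabulate (g ∘ ψ)        ≡⟨ cong (λ y → g y ∷ tabulate (g ∘ ψ ∘ suc)) eq ⟩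
  g (suc x) ∷ tabulate (g ∘ ψ ∘ suc) ∎
  where
  open ≡-Reasoning
  shifted : ∀ j → ∃ λ i → ψ j ≡ suc i
  shifted j = suc-preimage (ψ j) (ℕₚ.<-≤-trans (subst (Fin.zero {p} Fin.<_) (sym eq) (s≤s z≤n)) (mono {zero} {j} z≤n))
  φ : Fin (suc n) → Fin p
  φ = proj₁ ∘ shifted
  ψ≗suc : ψ ≗ suc ∘ φ
  ψ≗suc = proj₂ ∘ shifted
  φ-mono : Monotone φ
  φ-mono {i} {j} i≤j = ℕₚ.≤-pred (subst₂ Fin._≤_ (ψ≗suc i) (ψ≗suc j) (mono i≤j))

-- Induction of words

repeat : ℕ → A → List A
repeat e y = replicate (1 + e) y

-- Recursion on `m` peels off the letters of multiplicity one until only the zipped block is left.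
-- The multiplicities `c` are arbitrary so that they can be shifted along with `g`.
concat-repeat : ∀ {k} m → m + k ≡ p → (c : Fin p → ℕ) (e : Fin k → ℕ) (g : Fin p → A) →
                (∀ i → toℕ i < m → c i ≡ 1) →
                (∀ i l → toℕ i ≡ m + toℕ l → c i ≡ 1 + e l) →
                concat (tabulate λ i → replicate (c i) (g i)) ≡
                take m (tabulate g) ++ concat (zipWith repeat (tabulate e) (drop m (tabulate g)))
concat-repeat zero refl c e g c≡1 c≡e = cong concat (begin
  tabulate (λ i → replicate (c i) (g i))  ≡⟨ tabulate-cong (λ i → cong (λ s → replicate s (g i)) (c≡e i i refl)) ⟩
  tabulate (λ i → repeat (e i) (g i))     ≡⟨ zipWith-tabulate repeat e g ⟨
  zipWith repeat (tabulate e) (tabulate g) ∎)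
  where open ≡-Reasoning
concat-repeat (suc m) refl c e g c≡1 c≡e rewrite c≡1 zero (s≤s z≤n) =
  cong (g zero ∷_) (concat-repeat m refl (c ∘ suc) e (g ∘ suc)
    (λ i → c≡1 (suc i) ∘ s≤s) (λ i l → c≡e (suc i) l ∘ cong suc))

tabulate-↑ʷ : ∀ {k} m → m + k ≡ p → (c : Fin p → ℕ) (r : Fin k → ℕ) (g : Fin p → ℙ) →
              (∀ i → toℕ i < m → c i ≡ 1) →
              (∀ i l → toℕ i ≡ m + toℕ (opposite l) → c i ≡ 1 + r l) →
              tabulate g ↑ʷ r ≡ concat (tabulate λ i → replicate (c i) (g i))
tabulate-↑ʷ {k = k} m refl c r g c≡1 c≡r
  -- The cut `length u ∸ k` in `_↑ʷ_` becomes `m`.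
  rewrite length-tabulate g | ℕₚ.m+n∸n≡m m k =
  sym (concat-repeat m refl c (r ∘ opposite) g c≡1 λ i l eq →
    -- Exponents are listed as `r ∘ opposite`, so position `m + l` belongs to the class with index
    -- `opposite l`.
    c≡r i (opposite l) (trans eq (cong (λ x → m + toℕ x) (sym (Finₚ.opposite-involutive l)))))

-- Enumeration of words and of preimages under induction

∈-wordsOver⁺ : ∀ {D u} → All (_∈ D) u → u ∈ wordsOver D (length u)
∈-wordsOver⁺ []         = here refl
∈-wordsOver⁺ (y∈ ∷ ys∈) = ∈-cartesianProductWith⁺ _∷_ y∈ (∈-wordsOver⁺ ys∈)

∈-wordsOver⇒length : ∀ D q {u} → u ∈ wordsOver D q → length u ≡ q
∈-wordsOver⇒length D zero    (here refl) = refl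
∈-wordsOver⇒length D (suc q) u∈
  with _ , _ , _ , v∈ , refl ← ∈-cartesianProductWith⁻ _∷_ D (wordsOver D q) u∈
  = cong suc (∈-wordsOver⇒length D q v∈)

wordsOver-unique : ∀ {D} → Unique D → ∀ q → Unique (wordsOver D q)
wordsOver-unique D! zero    = [] ∷ []
wordsOver-unique D! (suc q) = cartesianProductWith⁺ _∷_ ∷-injective D! (wordsOver-unique D! q)

module _ {k : ℕ} (r : Fin k → ℕ) (w : Word) where

  private
    inducesTo? : (u : Word) → Dec (k ≤ length u × u ↑ʷ r ≡ w)
    inducesTo? u = (k ℕₚ.≤? length u) ×-dec ((u ↑ʷ r) ≟ʷ w)

    candidates : List Word
    candidates = wordsOver (deduplicate _≟ℙ_ w) (length w ∸ sum r)

  -- The conditions on length and letters place `u` in the finite search space; the first two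
  -- hypotheses pass it through the filter.
  ∈-preimages⁺ : ∀ {u} → k ≤ length u → u ↑ʷ r ≡ w → length u ≡ length w ∸ sum r →
                 (∀ {y} → y ∈ u → y ∈ w) → u ∈ preimages r w
  ∈-preimages⁺ {u} k≤ u↑ len u⊆w = ∈-filter⁺ inducesTo?
    (subst (λ q → u ∈ wordsOver (deduplicate _≟ℙ_ w) q) len
      (∈-wordsOver⁺ (All.tabulate (∈-deduplicate⁺ _≟ℙ_ ∘ u⊆w))))
    (k≤ , u↑)

  ∈-preimages⇒↑ʷ : ∀ {u} → u ∈ preimages r w → u ↑ʷ r ≡ w
  ∈-preimages⇒↑ʷ u∈ = proj₂ (proj₂ (∈-filter⁻ inducesTo? {xs = candidates} u∈))

  ∈-preimages⇒length : ∀ {u} → u ∈ preimages r w → length u ≡ length w ∸ sum r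
  ∈-preimages⇒length u∈ = ∈-wordsOver⇒length _ _ (proj₁ (∈-filter⁻ inducesTo? {xs = candidates} u∈))

  preimages-unique : Unique (preimages r w)
  preimages-unique = filter⁺ inducesTo? (wordsOver-unique (deduplicate-! w) (length w ∸ sum r))

-- Solutions of formulas

eval-cong : (B : Formula n) {f g : Fin n → ℙ} → f ≗ g → eval B f ≡ eval B g
eval-cong (i ≤′ j) f≗g = cong₂ (λ x y → does (value x ℕₚ.≤? value y)) (f≗g i) (f≗g j)
eval-cong false′   f≗g = refl
eval-cong (¬′ B)   f≗g = cong not (eval-cong B f≗g)
eval-cong (B ∧′ D) f≗g = cong₂ _∧_ (eval-cong B f≗g) (eval-cong D f≗g)
eval-cong (B ∨′ D) f≗g = cong₂ _∨_ (eval-cong B f≗g) (eval-cong D f≗g)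

eval-rename : (ρ : Fin n → Fin p) (B : Formula n) (g : Fin p → ℙ) → eval (rename ρ B) g ≡ eval B (g ∘ ρ)
eval-rename ρ (i ≤′ j) g = refl
eval-rename ρ false′   g = refl
eval-rename ρ (¬′ B)   g = cong not (eval-rename ρ B g)
eval-rename ρ (B ∧′ D) g = cong₂ _∧_ (eval-rename ρ B g) (eval-rename ρ D g)
eval-rename ρ (B ∨′ D) g = cong₂ _∨_ (eval-rename ρ B g) (eval-rename ρ D g)

indicator : Bool → ℤ
indicator b = if b then 1ℤ else 0ℤ

𝒮-tabulate : (B : Formula n) (f : Fin n → ℙ) → 𝒮 B (tabulate f) ≡ indicator (eval B f)
𝒮-tabulate {n} B f = at-lookup (tabulate f) (length-tabulate f) refl
  where
  -- The word is generalised to a variable so that `refl` can identify `n` with `length w`;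
  -- `length (tabulate f)` itself mentions `n`.
  at-lookup : ∀ w → length w ≡ n → w ≡ tabulate f → 𝒮 B w ≡ indicator (eval B f)
  at-lookup w len eq with length w ℕₚ.≟ n
  ... | yes refl = cong indicator
    (eval-cong B (tabulate-injective (trans (tabulate-lookup w) eq)))
  ... | no  len≢ = contradiction len len≢

𝒮-wrong-length : (B : Formula n) (w : Word) → length w ≢ n → 𝒮 B w ≡ 0ℤ
𝒮-wrong-length {n} B w len≢ with length w ℕₚ.≟ n
... | yes len = contradiction len len≢
... | no  _   = refl

not-∧-∨-false : ∀ {P Q : Set} (P? : Dec P) (Q? : Dec Q) {b} →
                not (does P? ∧ does Q?) ∨ b ≡ false → P × Q × b ≡ false
not-∧-∨-false (yes x) (yes y) eq = x , y , eq

⋁≠-false⁻ : (I : Edges n) (f : Fin n → ℙ) → eval (⋁≠ I) f ≡ false → ∀ {a b} → (a , b) ∈ I → f a ≡ f b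
⋁≠-false⁻ ((i , j) ∷ I) f eq ab∈
  with not-∧-∨-false (value (f i) ℕₚ.≤? value (f j)) (value (f j) ℕₚ.≤? value (f i)) eq | ab∈
... | i≤j , j≤i , _   | here refl  = value-injective (ℕₚ.≤-antisym i≤j j≤i)
... | _   , _   , eq′ | there ab∈I = ⋁≠-false⁻ I f eq′ ab∈I

⋁≠-false⁺ : (I : Edges n) (f : Fin n → ℙ) → (∀ {a b} → (a , b) ∈ I → f a ≡ f b) → eval (⋁≠ I) f ≡ false
⋁≠-false⁺ []            f f≡ = refl
⋁≠-false⁺ ((i , j) ∷ I) f f≡
  -- Once `f i` is replaced by `f j`, both comparisons in the first disjunct are reflexive.
  rewrite f≡ (here refl) | dec-true (value (f j) ℕₚ.≤? value (f j)) ℕₚ.≤-refl = ⋁≠-false⁺ I f (f≡ ∘ there)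

∈⇒occursIn : (I : Edges n) {a b : Fin n} → (a , b) ∈ I → a occursIn ⋁≠ I
∈⇒occursIn (_ ∷ I) (here refl) = inj₁ (inj₁ (inj₁ refl))
∈⇒occursIn (_ ∷ I) (there ab∈) = inj₂ (∈⇒occursIn I ab∈)

sum-zero : ∀ (F : A → ℤ) xs → (∀ {x} → x ∈ xs → F x ≡ 0ℤ) → foldr ℤ._+_ 0ℤ (map F xs) ≡ 0ℤ
sum-zero F []       F≡0 = refl
sum-zero F (x ∷ xs) F≡0 = cong₂ ℤ._+_ (F≡0 (here refl)) (sum-zero F xs (F≡0 ∘ there))

-- Contraction along the classes of a clause

module Contraction {n : ℕ} {C : Formula n} (c : ContractibleClause C) where
  open ContractibleClause c

  size : ℕ
  size = n ∸ sum r

  ∈O⇒m≤ : ∀ {i j} → j ∈ˢ O i → m Fin.≤ j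
  ∈O⇒m≤ j∈ = to (V-interval _) (from (O-cover _) (_ , j∈))

  -- By the ordering of the classes, a common element of two different ones would exceed itself.
  O-disjoint : ∀ {i i′ j} → j ∈ˢ O i → j ∈ˢ O i′ → i ≡ i′
  O-disjoint {i} {i′} j∈ j∈′ with Finₚ.<-cmp i i′
  ... | tri< i<i′ _ _ = contradiction (O-ordered i<i′ j∈ j∈′) (ℕₚ.<-irrefl refl)
  ... | tri≈ _ i≡i′ _ = i≡i′
  ... | tri> _ _ i′<i = contradiction (O-ordered i′<i j∈′ j∈) (ℕₚ.<-irrefl refl)

  -- A nonempty class contains a singleton, so the truncated subtraction in `r` loses nothing.
  ∣O∣≡1+r : ∀ i → ∣ O i ∣ ≡ 1 + r i
  ∣O∣≡1+r i with j , j∈ ← O-nonempty i = sym (ℕₚ.m+[n∸m]≡n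
    (subst (_≤ ∣ O i ∣) (∣⁅x⁆∣≡1 j) (p⊆q⇒∣p∣≤∣q∣ λ x∈ → subst (_∈ˢ O i) (sym (x∈⁅y⁆⇒x≡y j x∈)) j∈)))

  -- The case split inside `ψ` in a form that can be matched on. Since `opposite i` is `k - 1 - i`,
  -- the second value is the zero-based form of `m + k - i`.
  data ψ-View (j : Fin n) : Set where
    below : j Fin.< m → toℕ (ψ c j) ≡ toℕ j → ψ-View j
    inO   : ∀ i → j ∈ˢ O i → toℕ (ψ c j) ≡ toℕ m + toℕ (opposite i) → ψ-View j

  ψ-lt : ∀ {j} → j Fin.< m → toℕ (ψ c j) ≡ toℕ j
  ψ-lt {j} j<m with m Finₚ.≤? j
  ... | no  _   = Finₚ.toℕ-fromℕ< _
  ... | yes m≤j = contradiction m≤j (ℕₚ.<⇒≱ j<m)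

  ψ-ge : ∀ {j} → m Fin.≤ j → ∃ λ i → j ∈ˢ O i × toℕ (ψ c j) ≡ toℕ m + toℕ (opposite i)
  ψ-ge {j} m≤j with m Finₚ.≤? j
  ... | no  m≰j  = contradiction m≤j m≰j
  ... | yes m≤j′ = _ , proj₂ (to (O-cover j) (from (V-interval j) m≤j′)) , Finₚ.toℕ-fromℕ< _

  ψ-view : ∀ j → ψ-View j
  ψ-view j with ℕₚ.<-≤-connex (toℕ j) (toℕ m)
  ... | inj₁ j<m = below j<m (ψ-lt j<m)
  ... | inj₂ m≤j = let i , j∈ , eq = ψ-ge m≤j in inO i j∈ eq

  -- `ψ` uses whichever class `O-cover` returns; disjointness identifies it with `O i`.
  ψ-O : ∀ {i j} → j ∈ˢ O i → toℕ (ψ c j) ≡ toℕ m + toℕ (opposite i)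
  ψ-O j∈ with i′ , j∈′ , eq ← ψ-ge (∈O⇒m≤ j∈) rewrite O-disjoint j∈ j∈′ = eq

  opposite-cancel : ∀ {i i′ : Fin k} → toℕ m + toℕ (opposite i) ≡ toℕ m + toℕ (opposite i′) → i ≡ i′
  opposite-cancel {i} {i′} eq = begin
    i                       ≡⟨ Finₚ.opposite-involutive i ⟨
    opposite (opposite i)   ≡⟨ cong opposite (Finₚ.toℕ-injective (ℕₚ.+-cancelˡ-≡ (toℕ m) _ _ eq)) ⟩
    opposite (opposite i′)  ≡⟨ Finₚ.opposite-involutive i′ ⟩
    i′                      ∎
    where open ≡-Reasoning

  below≢inO : ∀ {j a} {A : Set} → j Fin.< m → toℕ (ψ c j) ≡ toℕ j → toℕ (ψ c j) ≡ toℕ m + a → A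
  below≢inO j<m eq eq′ =
    contradiction (subst (toℕ m ≤_) (trans (sym eq′) eq) (ℕₚ.m≤m+n (toℕ m) _)) (ℕₚ.<⇒≱ j<m)

  opposite-antitone : ∀ {i i′ : Fin k} → i Fin.≤ i′ → opposite i′ Fin.≤ opposite i
  opposite-antitone {i} {i′} i≤i′ = subst₂ _≤_ (sym (Finₚ.opposite-prop i′)) (sym (Finₚ.opposite-prop i))
    (ℕₚ.∸-monoʳ-≤ k (s≤s i≤i′))

  -- The classes decrease as their index grows, and `opposite` reverses the index: the two reversals
  -- cancel.
  ψ-monotone : Monotone (ψ c)
  ψ-monotone {i} {j} i≤j with ψ-view i | ψ-view j
  ... | below _ eq   | below _ eq′  = subst₂ _≤_ (sym eq) (sym eq′) i≤j
  ... | below i<m eq | inO _ _ eq′  = subst₂ _≤_ (sym eq) (sym eq′) (ℕₚ.≤-trans (ℕₚ.<⇒≤ i<m) (ℕₚ.m≤m+n (toℕ m) _))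
  ... | inO _ i∈ _   | below j<m _  = contradiction (ℕₚ.≤-trans (∈O⇒m≤ i∈) i≤j) (ℕₚ.<⇒≱ j<m)
  ... | inO a i∈ eq  | inO b j∈ eq′ with ℕₚ.<-≤-connex (toℕ a) (toℕ b)
  ...   | inj₁ a<b = contradiction i≤j (ℕₚ.<⇒≱ (O-ordered a<b i∈ j∈))
  ...   | inj₂ b≤a = subst₂ _≤_ (sym eq) (sym eq′) (ℕₚ.+-monoʳ-≤ (toℕ m) (opposite-antitone b≤a))

  -- Indices in classes go to positions at least `m`, so the fibre is the single index `j₀` with the
  -- same number as `x`.
  ∣fibre∣-below : ∀ x → toℕ x < toℕ m → ∣ fibre (ψ c) x ∣ ≡ 1
  ∣fibre∣-below x x<m = trans (cong ∣_∣ (⊆-antisym fibre⊆ ⊆fibre)) (∣⁅x⁆∣≡1 j₀)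
    where
    j₀ : Fin n
    j₀ = fromℕ< (ℕₚ.<-trans x<m (Finₚ.toℕ<n m))
    toℕ-j₀ : toℕ j₀ ≡ toℕ x
    toℕ-j₀ = Finₚ.toℕ-fromℕ< _
    fibre⊆ : ∀ {j} → j ∈ˢ fibre (ψ c) x → j ∈ˢ ⁅ j₀ ⁆
    fibre⊆ {j} j∈ with ψ-view j | ∈-fibre⁻ (ψ c) j∈
    ... | below _ eq | refl = subst (_∈ˢ ⁅ j₀ ⁆) (Finₚ.toℕ-injective (trans toℕ-j₀ eq)) (x∈⁅x⁆ j₀)
    ... | inO _ _ eq | refl = contradiction (subst (toℕ m ≤_) (sym eq) (ℕₚ.m≤m+n (toℕ m) _)) (ℕₚ.<⇒≱ x<m)
    ⊆fibre : ∀ {j} → j ∈ˢ ⁅ j₀ ⁆ → j ∈ˢ fibre (ψ c) x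
    ⊆fibre j∈ with refl ← x∈⁅y⁆⇒x≡y j₀ j∈ =
      ∈-fibre⁺ (ψ c) (Finₚ.toℕ-injective (trans (ψ-lt (subst (_< toℕ m) (sym toℕ-j₀) x<m)) toℕ-j₀))

  -- The fibre is the class `O i` itself; its size is the exponent prescribed by induction.
  ∣fibre∣-O : ∀ x i → toℕ x ≡ toℕ m + toℕ (opposite i) → ∣ fibre (ψ c) x ∣ ≡ 1 + r i
  ∣fibre∣-O x i x≡ = trans (cong ∣_∣ (⊆-antisym fibre⊆ ⊆fibre)) (∣O∣≡1+r i)
    where
    fibre⊆ : ∀ {j} → j ∈ˢ fibre (ψ c) x → j ∈ˢ O i
    fibre⊆ {j} j∈ with ψ-view j | ∈-fibre⁻ (ψ c) j∈
    ... | below j<m eq | refl = below≢inO j<m eq x≡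
    ... | inO i′ j∈′ eq | refl = subst (λ l → j ∈ˢ O l) (opposite-cancel (trans (sym eq) x≡)) j∈′
    ⊆fibre : ∀ {j} → j ∈ˢ O i → j ∈ˢ fibre (ψ c) x
    ⊆fibre j∈ = ∈-fibre⁺ (ψ c) (Finₚ.toℕ-injective (trans (ψ-O j∈) (sym x≡)))

  -- The exponents of the induction are the fibre sizes of `ψ c`, and monotonicity makes the letters
  -- of each fibre adjacent.
  tabulate-↑ʷ-ψ : (g : Fin size → ℙ) → tabulate g ↑ʷ r ≡ tabulate (g ∘ ψ c)
  tabulate-↑ʷ-ψ g = trans
    (tabulate-↑ʷ (toℕ m) (contracted-size c) (λ x → ∣ fibre (ψ c) x ∣) r g ∣fibre∣-below ∣fibre∣-O)
    (fibres≡tabulate (ψ c) ψ-monotone g)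

  ψ-surjective : ∀ x → ∃ λ j → ψ c j ≡ x
  ψ-surjective x with ℕₚ.<-≤-connex (toℕ x) (toℕ m)
  ... | inj₁ x<m = j , Finₚ.toℕ-injective (trans (ψ-lt (subst (_< toℕ m) (sym j≡x) x<m)) j≡x)
    where
    j : Fin n
    j = fromℕ< (ℕₚ.<-trans x<m (Finₚ.toℕ<n m))
    j≡x : toℕ j ≡ toℕ x
    j≡x = Finₚ.toℕ-fromℕ< _
  -- With `l` equal to `x - m`, any element of `O (opposite l)` goes to `m + l`, since `opposite` is
  -- an involution.
  ... | inj₂ m≤x = j , Finₚ.toℕ-injective (begin
      toℕ (ψ c j)                            ≡⟨ ψ-O j∈ ⟩
      toℕ m + toℕ (opposite (opposite l))    ≡⟨ cong (λ i → toℕ m + toℕ i) (Finₚ.opposite-involutive l) ⟩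
      toℕ m + toℕ l                          ≡⟨ cong (toℕ m +_) (Finₚ.toℕ-fromℕ< l<k) ⟩
      toℕ m + (toℕ x ∸ toℕ m)                ≡⟨ ℕₚ.m+[n∸m]≡n m≤x ⟩
      toℕ x                                  ∎)
    where
    open ≡-Reasoning
    l<k : toℕ x ∸ toℕ m < k
    l<k = subst (toℕ x ∸ toℕ m <_) (ℕₚ.m+n∸m≡n (toℕ m) k)
      (ℕₚ.∸-monoˡ-< (subst (toℕ x <_) (sym (contracted-size c)) (Finₚ.toℕ<n x)) m≤x)
    l : Fin k
    l = fromℕ< l<k
    j : Fin n
    j = proj₁ (O-nonempty (opposite l))
    j∈ : j ∈ˢ O (opposite l)
    j∈ = proj₂ (O-nonempty (opposite l))

  -- Assignments that factor through `ψ c`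

  Induced : Word → Set
  Induced w = ∃ λ (g : Fin size → ℙ) → w ≡ tabulate (g ∘ ψ c)

  C-false⇒factors : ∀ f → eval C f ≡ false → ∃ λ (g : Fin size → ℙ) → f ≗ g ∘ ψ c
  -- The factor is `f` composed with a section of `ψ c`; it is correct because `f` is constant on
  -- fibres.
  C-false⇒factors f Cf = (λ x → f (proj₁ (ψ-surjective x))) ,
                         (λ j → fibre-constant j _ (sym (proj₂ (ψ-surjective (ψ c j)))))
    where
    class-constant : ∀ {a b} → I ⊢ a ∼ b → f a ≡ f b
    -- Equality of values is an equivalence relation containing the edges, hence contains the
    -- relation they generate.
    class-constant = EqClosure.gfold isEquivalence f
      (⋁≠-false⁻ I f (subst (λ B → eval B f ≡ false) edge-like Cf))
    fibre-constant : ∀ j j′ → ψ c j ≡ ψ c j′ → f j ≡ f j′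
    fibre-constant j j′ ψ≡ with ψ-view j | ψ-view j′
    ... | below _ eq   | below _ eq′    = cong f (Finₚ.toℕ-injective (trans (sym eq) (trans (cong toℕ ψ≡) eq′)))
    ... | below j<m eq | inO _ _ eq′    = below≢inO j<m eq (trans (cong toℕ ψ≡) eq′)
    ... | inO _ _ eq   | below j′<m eq′ = below≢inO j′<m eq′ (trans (cong toℕ (sym ψ≡)) eq)
    ... | inO i j∈ eq  | inO i′ j′∈ eq′
      -- Equal positions at or above `m` come from the same class.
      with refl ← opposite-cancel (trans (sym eq) (trans (cong toℕ ψ≡) eq′)) =
      class-constant (to (O-class i j∈) j′∈)

  factors⇒C-false : ∀ f (g : Fin size → ℙ) → f ≗ g ∘ ψ c → eval C f ≡ false
  factors⇒C-false f g f≗ = subst (λ B → eval B f ≡ false) (sym edge-like) (⋁≠-false⁺ I f edge-constant)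
    where
    edge-constant : ∀ {a b} → (a , b) ∈ I → f a ≡ f b
    edge-constant {a} {b} ab∈
      -- The class of `a` also contains `b`, since the edge itself relates them, so both have the
      -- same position under `ψ c`.
      with i , a∈ ← to (O-cover a) (subst (a occursIn_) (sym edge-like) (∈⇒occursIn I ab∈)) = begin
      f a          ≡⟨ f≗ a ⟩
      g (ψ c a)    ≡⟨ cong g (Finₚ.toℕ-injective (trans (ψ-O a∈) (sym (ψ-O b∈)))) ⟩
      g (ψ c b)    ≡⟨ f≗ b ⟨
      f b          ∎
      where
      open ≡-Reasoning
      b∈ : b ∈ˢ O i
      b∈ = from (O-class i a∈) (EqClosure.return ab∈)

  -- A preimage of length `size` is some `tabulate g` and would exhibit `w` as induced; a preimage
  -- of any other length has coefficient zero.
  ↑-not-induced : (T : Formula size) (w : Word) → ¬ Induced w → (𝒮 T ↑ r) w ≡ 0ℤ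
  ↑-not-induced T w not-induced = sum-zero (𝒮 T) (preimages r w) λ {u} u∈ →
    𝒮-wrong-length T u λ len → let g , u≡ = length≡⇒tabulate u len in
    not-induced (g , trans (sym (∈-preimages⇒↑ʷ r w u∈)) (trans (cong (_↑ʷ r) u≡) (tabulate-↑ʷ-ψ g)))

  -- Surjectivity of `ψ c` is used twice: it recovers `g` from `g ∘ ψ c`, so no other preimage
  -- exists, and it puts every letter of `g` into the induced word, so the search finds
  -- `tabulate g`.
  preimages-tabulate : (g : Fin size → ℙ) → preimages r (tabulate (g ∘ ψ c)) ≡ tabulate g ∷ []
  preimages-tabulate g = unique-constant (preimages-unique r w)
    (∈-preimages⁺ r w k≤ (tabulate-↑ʷ-ψ g) (trans (length-tabulate g) (sym len-w)) letters)
    λ {u} u∈ → let g′ , u≡ = length≡⇒tabulate u (trans (∈-preimages⇒length r w u∈) len-w) in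
      trans u≡ (tabulate-cong (g′≗g g′ (trans (sym (tabulate-↑ʷ-ψ g′))
        (trans (cong (_↑ʷ r) (sym u≡)) (∈-preimages⇒↑ʷ r w u∈)))))
    where
    w : Word
    w = tabulate (g ∘ ψ c)
    len-w : length w ∸ sum r ≡ size
    len-w = cong (_∸ sum r) (length-tabulate (g ∘ ψ c))
    k≤ : k ≤ length (tabulate g)
    k≤ = subst (k ≤_) (trans (contracted-size c) (sym (length-tabulate g))) (ℕₚ.m≤n+m k (toℕ m))
    letters : ∀ {y} → y ∈ tabulate g → y ∈ w
    letters y∈ with x , refl ← ∈-tabulate⁻ y∈ with j , refl ← ψ-surjective x = ∈-tabulate⁺ j
    g′≗g : ∀ g′ → tabulate (g′ ∘ ψ c) ≡ tabulate (g ∘ ψ c) → g′ ≗ g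
    g′≗g g′ eq x with j , refl ← ψ-surjective x = tabulate-injective eq j

  ↑-induced : (T : Formula size) (g : Fin size → ℙ) →
              (𝒮 T ↑ r) (tabulate (g ∘ ψ c)) ≡ indicator (eval T g)
  ↑-induced T g = begin
    foldr ℤ._+_ 0ℤ (map (𝒮 T) (preimages r (tabulate (g ∘ ψ c))))
      ≡⟨ cong (foldr ℤ._+_ 0ℤ ∘ map (𝒮 T)) (preimages-tabulate g) ⟩
    𝒮 T (tabulate g) ℤ.+ 0ℤ  ≡⟨ ℤₚ.+-identityʳ _ ⟩
    𝒮 T (tabulate g)         ≡⟨ 𝒮-tabulate T g ⟩
    indicator (eval T g)     ∎
    where open ≡-Reasoning

  -- Comparison of coefficients

  module _ (S′ : Formula n) where

    private
      lost : Series
      lost = 𝒮 (contraction c S′) ↑ r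

    𝒮-∧-C-tabulate : ∀ f → indicator (eval (S′ ∧′ C) f) ≡ indicator (eval S′ f) ℤ.- lost (tabulate f)
    𝒮-∧-C-tabulate f with eval C f in Cf
    ... | true  = begin
      indicator (eval S′ f ∧ true)     ≡⟨ cong indicator (∧-identityʳ (eval S′ f)) ⟩
      indicator (eval S′ f)            ≡⟨ ℤₚ.+-identityʳ _ ⟨
      indicator (eval S′ f) ℤ.- 0ℤ
        ≡⟨ cong (λ z → indicator (eval S′ f) ℤ.- z) (sym (↑-not-induced (contraction c S′) (tabulate f) not-induced)) ⟩
      indicator (eval S′ f) ℤ.- lost (tabulate f) ∎
      where
      open ≡-Reasoning
      not-induced : ¬ Induced (tabulate f)
      not-induced (g , eq) with () ← trans (sym Cf) (factors⇒C-false f g (tabulate-injective eq))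
    -- Here the coefficient of `lost` equals that of `𝒮 S′`, so the difference vanishes.
    ... | false with g , f≗ ← C-false⇒factors f Cf = begin
      indicator (eval S′ f ∧ false)  ≡⟨ cong indicator (∧-zeroʳ (eval S′ f)) ⟩
      0ℤ                             ≡⟨ ℤₚ.+-inverseʳ (indicator (eval S′ f)) ⟨
      indicator (eval S′ f) ℤ.- indicator (eval S′ f) ≡⟨ cong (λ z → indicator (eval S′ f) ℤ.- z) (sym (lost≡ g f≗)) ⟩
      indicator (eval S′ f) ℤ.- lost (tabulate f) ∎
      where
      open ≡-Reasoning
      lost≡ : ∀ g → f ≗ g ∘ ψ c → lost (tabulate f) ≡ indicator (eval S′ f)
      lost≡ g f≗ = begin
        lost (tabulate f)                       ≡⟨ cong lost (tabulate-cong f≗) ⟩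
        lost (tabulate (g ∘ ψ c))               ≡⟨ ↑-induced (contraction c S′) g ⟩
        indicator (eval (contraction c S′) g)   ≡⟨ cong indicator (eval-rename (ψ c) S′ g) ⟩
        indicator (eval S′ (g ∘ ψ c))           ≡⟨ cong indicator (eval-cong S′ f≗) ⟨
        indicator (eval S′ f)                   ∎

    𝒮-∧-C : 𝒮 (S′ ∧′ C) ≗ 𝒮 S′ -ˢ lost
    𝒮-∧-C w = [ at-tabulate ∘ length≡⇒tabulate w , off-length ]′ (toSum (length w ℕₚ.≟ n))
      where
      open ≡-Reasoning
      at-tabulate : (∃ λ (f : Fin n → ℙ) → w ≡ tabulate f) → 𝒮 (S′ ∧′ C) w ≡ (𝒮 S′ -ˢ lost) w
      at-tabulate (f , refl) = begin
        𝒮 (S′ ∧′ C) (tabulate f)                     ≡⟨ 𝒮-tabulate (S′ ∧′ C) f ⟩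
        indicator (eval (S′ ∧′ C) f)                 ≡⟨ 𝒮-∧-C-tabulate f ⟩
        indicator (eval S′ f) ℤ.- lost (tabulate f)  ≡⟨ cong (λ z → z ℤ.- lost (tabulate f)) (𝒮-tabulate S′ f) ⟨
        (𝒮 S′ -ˢ lost) (tabulate f)                  ∎
      off-length : length w ≢ n → 𝒮 (S′ ∧′ C) w ≡ (𝒮 S′ -ˢ lost) w
      -- An induced word has length `n`, so in other degrees all three coefficients are zero.
      off-length len≢ = trans (𝒮-wrong-length (S′ ∧′ C) w len≢)
        (sym (cong₂ ℤ._-_ (𝒮-wrong-length S′ w len≢) (↑-not-induced (contraction c S′) w λ (g , w≡) →
          len≢ (trans (cong length w≡) (length-tabulate (g ∘ ψ c))))))

theorem3p8 : ∀ {n : ℕ} (S S′ C : Formula n) → S ≡ S′ ∧′ C →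
    (c : ContractibleClause C) →
    𝒮 S ≗ 𝒮 S′ -ˢ (𝒮 (contraction c S′) ↑ ContractibleClause.r c)
theorem3p8 _ S′ C refl c = Contraction.𝒮-∧-C c S′
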